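{- For any $A$-labeled pair of twin binary search trees $(T_L, T_R)$ as input, the algorithm ExtractBaxter computes a word belonging to the $\equiv_{\mathrm{B}}$-equivalence class encoded by $(T_L, T_R)$. Moreover, if $(T_L, T_R)$ is labeled by a permutation, the computed word is a Baxter permutation.
   Context: $A = \{a_1 < a_2 < \cdots\}$ is a totally ordered infinite alphabet and $A^*$ is the free monoid of words on $A$. The Baxter congruence $\equiv_{\mathrm{B}}$ is the smallest congruence (equivalence relation compatible with concatenation) on $A^*$ such that, for all words $u, v$ and letters $a,b,c,d$: $\; c\,u\,a d\,v\,b \equiv_{\mathrm{B}} c\,u\,d a\,v\,b$ whenever $a \leq b < c \leq d$, and $\; b\,u\,d a\,v\,c \equiv_{\mathrm{B}} b\,u\,a d\,v\,c$ whenever $a < b \leq c < d$. A binary tree is either a leaf (empty tree) or a node with a left and a right binary subtree. The $i$-th node is the $i$-th node visited by the inorder traversal (left subtree, root, right subtree); the inorder reading of a labeled tree is the word of labels in this order. The canopy of a binary tree with $n$ nodes is the word of length $n-1$ obtained by reading its leaves from left to right except the first and the last, writing $0$ if the leaf is a right child and $1$ if it is a left child. Two binary trees $(T_L,T_R)$ with $n$ nodes form a pair of twin binary trees if their canopies differ at every position $1\le i\le n-1$. A tree labeled by $A$ is a right (resp. left) binary search tree if for each node labeled $b$, all labels $a$ in its left subtree and $c$ in its right subtree satisfy $a \leq b < c$ (resp. $a < b \leq c$). A pair of twin binary search trees is an $A$-labeled pair of twin binary trees $(T_L,T_R)$ with $T_L$ a left binary search tree, $T_R$ a right binary search tree, and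 both having the same inorder reading. It is labeled by a permutation if the labels of each tree with $n$ nodes are $1,\dots,n$, each used once. Leaf insertion of a letter $a$ into a right (resp. left) binary search tree: in the empty tree, create a node labeled $a$; otherwise, with $b$ the root label, insert recursively into the left subtree if $a \leq b$ (resp. $a<b$), and into the right subtree otherwise. For $u \in A^*$, $\mathsf{P}(u) = (T_L,T_R)$ where $T_L$ (resp. $T_R$) is the left (resp. right) binary search tree obtained by leaf inserting the letters of $u$ from left to right (resp. right to left). The class encoded by $(T_L,T_R)$ is the $\equiv_{\mathrm{B}}$-equivalence class of the words $u$ with $\mathsf{P}(u) = (T_L,T_R)$. A permutation $\sigma$ is a Baxter permutation if for any subword $u_1u_2u_3u_4$ of $\sigma$ such that $u_2$ and $u_3$ are adjacent in $\sigma$, the standardization of $u_1u_2u_3u_4$ is neither $2413$ nor $3142$. For binary trees $T_0,T_1$ (labeled or not), $T_0 / T_1$ is obtained by grafting $T_0$ from its root on the leftmost leaf of $T_1$, and $T_0 \backslash T_1$ by grafting $T_1$ from its root on the rightmost leaf of $T_0$. Algorithm ExtractBaxter, on input $(T_L,T_R)$: (1) let $u$ be the empty word. (2) While $T_L$ and $T_R$ are not empty: (a) let $a$ be the label of the root of $T_L$; (b) let $i$ be the (inorder) index of the root of $T_L$; (c) set $u := u a$; (d) let $A'$ (resp. $B'$) be the left (resp. right) subtree of $T_L$; (e) if the $i$-th node of $T_R$ is a left child in $T_R$, set $T_L := A' / B'$, otherwise set $T_L := A' \backslash B'$; (f) suppress the $i$-th node in $T_R$ (this node has no child in $T_R$).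 (3) Return $u$. -}

module Defs where

open import Data.Bool using (Bool; true; false; if_then_else_)
open import Data.Digit using (Bit; 0b; 1b)
open import Data.List using (List; []; _∷_; [_]; _++_; _∷ʳ_; length; filter; take; drop; foldl; foldr; applyUpTo)
open import Data.List.Relation.Binary.Permutation.Propositional using (_↭_)
open import Data.List.Relation.Binary.Pointwise using (Pointwise)
open import Data.Maybe using (Maybe; just; nothing; _>>=_)
import Data.Maybe as Maybe
open import Data.Nat using (ℕ; zero; suc; _+_; _∸_; _≤_; _<_; _≤?_; _<?_)
open import Data.Nat.Properties using (<-cmp)
open import Data.Product using (_×_; _,_; ∃-syntax)
open import Data.Tree.Binary using (Tree; leaf; node; #nodes; module Infix)
open import Data.Tree.Binary.Relation.Unary.All using (All)
open import Data.Unit using (⊤; tt)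
open import Function using (flip)
open import Level using (0ℓ)
open import Relation.Binary.Core using (Rel)
open import Relation.Binary.Definitions using (Decidable; tri<; tri≈; tri>)
open import Relation.Binary.PropositionalEquality using (_≡_; _≢_)
open import Relation.Nullary using (does)
open import Relation.Unary using (U)

-- An alphabet {a₁ < a₂ < ⋯} is order-isomorphic to ℕ, which serves as the
-- alphabet here; a permutation of size n is then a word on the letters 1, …, n.
Letter : Set
Letter = ℕ

Word : Set
Word = List Letter

infix 4 _≡B_

data _≡B_ : Word → Word → Set where
  refl    : ∀ {u} → u ≡B u
  sym     : ∀ {u v} → u ≡B v → v ≡B u
  trans   : ∀ {u v w} → u ≡B v → v ≡B w → u ≡B w
  ++-cong : ∀ {u u′ v v′} → u ≡B u′ → v ≡B v′ → u ++ v ≡B u′ ++ v′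
  cadb    : ∀ u v {a b c d} → a ≤ b → b < c → c ≤ d →
            c ∷ u ++ a ∷ d ∷ v ++ [ b ] ≡B c ∷ u ++ d ∷ a ∷ v ++ [ b ]
  bdac    : ∀ u v {a b c d} → a < b → b ≤ c → c < d →
            b ∷ u ++ d ∷ a ∷ v ++ [ c ] ≡B b ∷ u ++ a ∷ d ∷ v ++ [ c ]

BinTree : Set → Set
BinTree N = Tree N ⊤

pattern empty = leaf tt

private
  variable
    N : Set

-- Every leaf other than a lone root is a left child (1) or a right child (0);
-- the bit passed down says which of the two the current subtree is.
leafBits : Bit → BinTree N → List Bit
leafBits s empty        = [ s ]
leafBits s (node l _ r) = leafBits 1b l ++ leafBits 0b r

-- A tree with n ≥ 1 nodes has n + 1 leaves, so dropping the first and keeping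
-- the next n ∸ 1 leaves out exactly the first and the last. The value for the
-- empty tree is [], whatever the initial bit.
canopy : BinTree N → List Bit
canopy t = take (#nodes t ∸ 1) (drop 1 (leafBits 0b t))

Twin : BinTree N → BinTree N → Set
Twin TL TR = #nodes TL ≡ #nodes TR × Pointwise _≢_ (canopy TL) (canopy TR)

data BST (_◁_ _▷_ : Rel Letter 0ℓ) : BinTree Letter → Set where
  leaf : BST _◁_ _▷_ empty
  node : ∀ {l b r} → All (λ a → a ◁ b) U l → All (λ c → b ▷ c) U r →
         BST _◁_ _▷_ l → BST _◁_ _▷_ r → BST _◁_ _▷_ (node l b r)

LeftBST RightBST : BinTree Letter → Set
LeftBST  = BST _<_ _≤_
RightBST = BST _≤_ _<_

record TwinBST (TL TR : BinTree Letter) : Set where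
  field
    twin     : Twin TL TR
    leftBST  : LeftBST TL
    rightBST : RightBST TR
    inorder  : Infix.toList TL ≡ Infix.toList TR

LabeledByPermutation : BinTree Letter → Set
LabeledByPermutation t = Infix.toList t ↭ applyUpTo suc (#nodes t)

leafInsert : {_◁_ : Rel Letter 0ℓ} → Decidable _◁_ → Letter → BinTree Letter → BinTree Letter
leafInsert _◁?_ a empty        = node empty a empty
leafInsert _◁?_ a (node l b r) =
  if does (a ◁? b) then node (leafInsert _◁?_ a l) b r
                   else node l b (leafInsert _◁?_ a r)

insertᴸ insertᴿ : Letter → BinTree Letter → BinTree Letter
insertᴸ = leafInsert _<?_
insertᴿ = leafInsert _≤?_

-- foldl inserts the first letter first, foldr the last letter first.
P : Word → BinTree Letter × BinTree Letter
P u = foldl (flip insertᴸ) empty u , foldr insertᴿ empty u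

InEncodedClass : BinTree Letter × BinTree Letter → Word → Set
InEncodedClass T w = ∃[ u ] (P u ≡ T × w ≡B u)

-- std(u)ᵢ = 1 + #{j < i ∣ uⱼ ≤ uᵢ} + #{j > i ∣ uⱼ < uᵢ}, so that equal letters are
-- numbered from left to right. The first argument holds the letters already read.
standardizeAfter : Word → Word → Word
standardizeAfter before []      = []
standardizeAfter before (x ∷ u) =
  suc (length (filter (_≤? x) before) + length (filter (_<? x) u)) ∷ standardizeAfter (x ∷ before) u

standardize : Word → Word
standardize = standardizeAfter []

IsPermutation : Word → Set
IsPermutation σ = σ ↭ applyUpTo suc (length σ)

record IsBaxterPermutation (σ : Word) : Set where
  field
    isPermutation : IsPermutation σ
    avoids        : ∀ p q r s {u₁ u₂ u₃ u₄} →
                    σ ≡ p ++ u₁ ∷ q ++ u₂ ∷ u₃ ∷ r ++ u₄ ∷ s →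
                    let τ = standardize (u₁ ∷ u₂ ∷ u₃ ∷ u₄ ∷ []) in
                    τ ≢ 2 ∷ 4 ∷ 1 ∷ 3 ∷ [] × τ ≢ 3 ∷ 1 ∷ 4 ∷ 2 ∷ []

infixr 6 _╱_ _╲_

_╱_ : BinTree N → BinTree N → BinTree N
s ╱ empty      = s
s ╱ node l b r = node (s ╱ l) b r

_╲_ : BinTree N → BinTree N → BinTree N
empty      ╲ t = t
node l b r ╲ t = node l b (r ╲ t)

-- Inorder indices are counted from 0, so the root of `node l b r` has index
-- #nodes l and the index in r of a node to its right is smaller by 1 + #nodes l.
-- The Boolean records whether the current subtree is the left subtree of its parent.
isLeftChildIn : Bool → ℕ → BinTree N → Bool
isLeftChildIn s i empty = false
isLeftChildIn s i (node l _ r) with <-cmp i (#nodes l)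
... | tri< _ _ _ = isLeftChildIn true i l
... | tri≈ _ _ _ = s
... | tri> _ _ _ = isLeftChildIn false (i ∸ suc (#nodes l)) r

-- The root of the whole tree is not a left child.
isLeftChild : ℕ → BinTree N → Bool
isLeftChild = isLeftChildIn false

-- Suppresses the node of index i; undefined unless that node exists and has no child.
suppress : ℕ → BinTree N → Maybe (BinTree N)
suppress i empty = nothing
suppress i (node l b r) with <-cmp i (#nodes l)
... | tri< _ _ _ = Maybe.map (λ l′ → node l′ b r) (suppress i l)
... | tri> _ _ _ = Maybe.map (λ r′ → node l b r′) (suppress (i ∸ suc (#nodes l)) r)
suppress i (node empty b empty) | tri≈ _ _ _ = just empty
suppress i (node _     b _    ) | tri≈ _ _ _ = nothing

-- `loop n TL TR u` runs the while loop for at most n iterations from the state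
-- (TL, TR, u). It gives nothing if a suppression is undefined or if the loop has
-- not ended by then, so a result `just w` means that the algorithm returns w.
loop : ℕ → BinTree Letter → BinTree Letter → Word → Maybe Word
loop n       empty           TR              u = just u
loop n       (node _ _ _)    empty           u = just u
loop zero    (node _ _ _)    (node _ _ _)    u = nothing
loop (suc n) (node A′ a B′)  TR@(node _ _ _) u =
  suppress i TR >>= λ TR′ →
  loop n (if isLeftChild i TR then A′ ╱ B′ else A′ ╲ B′) TR′ (u ∷ʳ a)
  where
  i : ℕ
  i = #nodes A′

-- Each iteration removes one node of TL.
extractBaxter : BinTree Letter → BinTree Letter → Maybe Word
extractBaxter TL TR = loop (#nodes TL) TL TR []

{-# OPTIONS --safe #-}
-- Every iteration moves the root a of T_L to the end of the word and replaces T_L = (A′, a, B′)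
-- by a grafting of A′ and B′.
--
-- The word w found in this way satisfies P(w) = (T_L, T_R). On the left, inserting a first and
-- then w′ amounts to inserting a at the root of the tree of w′, which splits that tree into its
-- letters < a and ≥ a; both graftings split back into A′ and B′. On the right, since the canopies
-- differ, the two leaves around the node of T_R facing the root of T_L are a left child and a
-- right child, so that this node has no child; suppressing it merges these two leaves into one
-- of the same kind as the node, and the choice of the grafting makes the two leaves of T_L
-- merge into one of the other kind.
--
-- Whatever graftings are chosen, w avoids 2-41-3 and 3-14-2. Suppose b … d a … c occurs with
-- a < b < c < d, and take the last possible b. When b is extracted, a lies in A′ and c, d in B′.
-- If A′ ╲ B′ is chosen, then some y in A′ with a ≤ y < b is an ancestor of d, hence precedes d;
-- if A′ ╱ B′ is chosen, then some y in B′ with b ≤ y ≤ c is an ancestor of a, hence precedes a.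
-- So y occurs before d a, which excludes y = a and y = c, and y can replace b: a contradiction.
-- The pattern 3-14-2 is symmetric.

module Submission where

open import Defs hiding (refl; sym; trans)
open import Data.Bool using (Bool; true; false; not; if_then_else_)
open import Data.Digit using (Bit; 0b; 1b)
open import Data.Empty using (⊥)
import Data.Fin as Fin
open import Data.List using (List; []; _∷_; [_]; _++_; _∷ʳ_; length; take; filter; foldl; foldr; applyUpTo)
open import Data.List.Properties using (++-assoc; ++-identityʳ; length-++; ∷-injective; ∷-injectiveˡ; ∷-injectiveʳ; ∷ʳ-injectiveˡ; ∷ʳ-injectiveʳ; take-[]; filter-all; filter-none; filter-some; filter-accept; filter-reject; filter-complete; length-filter)
open import Data.List.Membership.Propositional using (_∈_; _∉_)
open import Data.List.Membership.Propositional.Properties using (∈-++⁺ˡ; ∈-++⁺ʳ; ∈-++⁻; ∈-∃++; ∈-insert)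
open import Data.List.Relation.Binary.Permutation.Propositional using (_↭_; ↭-sym; ↭-trans; ↭-reflexive; prep; ↭⇒↭ₛ)
open import Data.List.Relation.Binary.Permutation.Propositional.Properties using (∈-resp-↭; shift; ↭-length)
open import Data.List.Relation.Binary.Pointwise using (Pointwise; []; _∷_; Pointwise-length)
import Data.List.Relation.Binary.Pointwise as Pointwise
open import Data.List.Relation.Binary.Sublist.Propositional using (_⊆_; []; _∷_; from∈)
import Data.List.Relation.Binary.Sublist.Propositional as Sublist
import Data.List.Relation.Unary.All as ListAll
import Data.List.Relation.Unary.All.Properties as ListAllₚ
open import Data.List.Relation.Unary.Any using (here; there)
open import Data.List.Relation.Unary.AllPairs using ([]; _∷_)
open import Data.List.Relation.Unary.Unique.Propositional using (Unique)
open import Data.List.Relation.Unary.Unique.Propositional.Properties using (applyUpTo⁺₁; Unique[x∷xs]⇒x∉xs)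
open import Data.Maybe using (just; _>>=_)
import Data.Maybe as Maybe
open import Data.Nat using (ℕ; zero; suc; _+_; _∸_; _≤_; _<_; _≤?_; _<?_; s≤s; z≤n)
open import Data.Nat.Properties
open import Data.Product using (_×_; _,_; ∃-syntax; proj₁; proj₂)
open import Data.Sum using (_⊎_; inj₁; inj₂)
open import Data.Tree.Binary using (leaf; node; #nodes; module Infix)
open import Data.Tree.Binary.Relation.Unary.All using (All; leaf; node; mapₙ)
open import Data.Unit using (⊤; tt)
open import Function using (flip; _∘_)
open import Level using (0ℓ)
open import Relation.Binary.Definitions using (tri<; tri≈; tri>)
open import Relation.Binary.PropositionalEquality using (_≡_; _≢_; refl; sym; trans; cong; cong₂; subst; subst₂; setoid; module ≡-Reasoning)
open import Data.List.Relation.Binary.Permutation.Setoid.Properties (setoid ℕ) using (Unique-resp-↭)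
open import Relation.Nullary using (does; yes; no; ¬_; contradiction)
open import Relation.Nullary.Decidable using (dec-true; dec-false)
open import Relation.Unary using (Pred; U; ∁)
import Relation.Unary as Unary

private
  variable
    N : Set
    a b c d x y : Letter
    s t l r A B T : BinTree N
    w : Word

-- Trees and their inorder readings

-- Written with `_++_` to suit inductions on trees, whereas `Infix.toList` goes through difference
-- lists.
labels : BinTree N → List N
labels empty        = []
labels (node l x r) = labels l ++ x ∷ labels r

toDiffList≗labels++ : (t : BinTree N) (xs : List N) → Infix.toDiffList t xs ≡ labels t ++ xs
toDiffList≗labels++ empty        xs = refl
toDiffList≗labels++ (node l x r) xs = begin
  Infix.toDiffList l (x ∷ Infix.toDiffList r xs) ≡⟨ toDiffList≗labels++ l _ ⟩
  labels l ++ x ∷ Infix.toDiffList r xs          ≡⟨ cong (λ ys → labels l ++ x ∷ ys) (toDiffList≗labels++ r xs) ⟩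
  labels l ++ x ∷ labels r ++ xs                 ≡⟨ ++-assoc (labels l) (x ∷ labels r) xs ⟨
  (labels l ++ x ∷ labels r) ++ xs               ∎
  where open ≡-Reasoning

toList≡labels : (t : BinTree N) → Infix.toList t ≡ labels t
toList≡labels t = trans (toDiffList≗labels++ t []) (++-identityʳ (labels t))

length-labels : (t : BinTree N) → length (labels t) ≡ #nodes t
length-labels empty        = refl
length-labels (node l x r) =
  trans (length-++ (labels l)) (cong₂ (λ m n → m + suc n) (length-labels l) (length-labels r))

lookup-labels : {P : Pred N 0ℓ} → All P U t → ∀ {x} → x ∈ labels t → P x
lookup-labels {t = node l y r} (node pl py pr) x∈ with ∈-++⁻ (labels l) x∈
... | inj₁ x∈l          = lookup-labels pl x∈l
... | inj₂ (here refl)  = py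
... | inj₂ (there x∈r)  = lookup-labels pr x∈r

-- `c` stands for the answer of `isLeftChild` at the node of T_R that faces the root of T_L.
graft : Bool → BinTree N → BinTree N → BinTree N
graft c s t = if c then s ╱ t else s ╲ t

All-╱ : {P : Pred N 0ℓ} → All P U s → All P U t → All P U (s ╱ t)
All-╱ {t = empty}      ps _               = ps
All-╱ {t = node _ _ _} ps (node pl py pr) = node (All-╱ ps pl) py pr

All-╲ : {P : Pred N 0ℓ} → All P U s → All P U t → All P U (s ╲ t)
All-╲ {s = empty}      _               pt = pt
All-╲ {s = node _ _ _} (node pl py pr) pt = node pl py (All-╲ pr pt)

labels-╱ : (s t : BinTree N) → labels (s ╱ t) ≡ labels s ++ labels t
labels-╱ s empty        = sym (++-identityʳ (labels s))
labels-╱ s (node l x r) =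
  trans (cong (_++ x ∷ labels r) (labels-╱ s l)) (++-assoc (labels s) (labels l) (x ∷ labels r))

labels-╲ : (s t : BinTree N) → labels (s ╲ t) ≡ labels s ++ labels t
labels-╲ empty        t = refl
labels-╲ (node l x r) t =
  trans (cong (λ ys → labels l ++ x ∷ ys) (labels-╲ r t)) (sym (++-assoc (labels l) (x ∷ labels r) (labels t)))

labels-graft : ∀ c (s t : BinTree N) → labels (graft c s t) ≡ labels s ++ labels t
labels-graft true  = labels-╱
labels-graft false = labels-╲

-- The nodes of `t` that receive `s` in their left subtrees have labels at least `a`, above all
-- labels of `s`.
leftBST-╱ : All (_< a) U s → All (a ≤_) U t → LeftBST s → LeftBST t → LeftBST (s ╱ t)
leftBST-╱ {t = empty} _ _ bs _ = bs
leftBST-╱ {t = node _ _ _} s<a (node a≤l a≤x _) bs (node l<x x≤r bl br) =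
  node (All-╱ (mapₙ (λ y<a → <-≤-trans y<a a≤x) s<a) l<x) x≤r (leftBST-╱ s<a a≤l bs bl) br

leftBST-╲ : All (_< a) U s → All (a ≤_) U t → LeftBST s → LeftBST t → LeftBST (s ╲ t)
leftBST-╲ {s = empty} _ _ _ bt = bt
leftBST-╲ {s = node _ _ _} (node _ x<a r<a) a≤t (node l<x x≤r bl br) bt =
  node l<x (All-╲ x≤r (mapₙ (λ a≤y → ≤-trans (<⇒≤ x<a) a≤y) a≤t)) bl (leftBST-╲ r<a a≤t br bt)

leftBST-graft : ∀ c → LeftBST (node A a B) → LeftBST (graft c A B)
leftBST-graft true  (node A<a a≤B bA bB) = leftBST-╱ A<a a≤B bA bB
leftBST-graft false (node A<a a≤B bA bB) = leftBST-╲ A<a a≤B bA bB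

-- Insertion at the root

insertᴸ-< : ∀ l r → x < b → insertᴸ x (node l b r) ≡ node (insertᴸ x l) b r
insertᴸ-< {x} {b} l r x<b =
  cong (λ e → if e then node (insertᴸ x l) b r else node l b (insertᴸ x r)) (dec-true (x <? b) x<b)

insertᴸ-≮ : ∀ l r → ¬ x < b → insertᴸ x (node l b r) ≡ node l b (insertᴸ x r)
insertᴸ-≮ {x} {b} l r x≮b =
  cong (λ e → if e then node (insertᴸ x l) b r else node l b (insertᴸ x r)) (dec-false (x <? b) x≮b)

-- Root insertion of `a` cuts a tree along the path that turns right exactly at the labels < `a`.
-- Letters equal to `a` thus fall to the right, as a left binary search tree requires.
below notBelow : Letter → BinTree Letter → BinTree Letter
below a empty        = empty
below a (node l b r) = if does (b <? a) then node l b (below a r) else below a l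
notBelow a empty        = empty
notBelow a (node l b r) = if does (b <? a) then notBelow a r else node (notBelow a l) b r

below-< : ∀ l r → b < a → below a (node l b r) ≡ node l b (below a r)
below-< {b} {a} l r b<a =
  cong (λ e → if e then node l b (below a r) else below a l) (dec-true (b <? a) b<a)

below-≮ : ∀ l r → ¬ b < a → below a (node l b r) ≡ below a l
below-≮ {b} {a} l r b≮a =
  cong (λ e → if e then node l b (below a r) else below a l) (dec-false (b <? a) b≮a)

notBelow-< : ∀ l r → b < a → notBelow a (node l b r) ≡ notBelow a r
notBelow-< {b} {a} l r b<a =
  cong (λ e → if e then notBelow a r else node (notBelow a l) b r) (dec-true (b <? a) b<a)

notBelow-≮ : ∀ l r → ¬ b < a → notBelow a (node l b r) ≡ node (notBelow a l) b r
notBelow-≮ {b} {a} l r b≮a =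
  cong (λ e → if e then notBelow a r else node (notBelow a l) b r) (dec-false (b <? a) b≮a)

insertRoot : Letter → BinTree Letter → BinTree Letter
insertRoot a t = node (below a t) a (notBelow a t)

-- As x < a, insertion and cutting take the same turn except at a node b with x < b < a. There x
-- enters the left subtree, which `below` keeps whole and `notBelow` discards.
insertᴸ-below : x < a → ∀ t → insertᴸ x (below a t) ≡ below a (insertᴸ x t)
                            × notBelow a t ≡ notBelow a (insertᴸ x t)
insertᴸ-below {x} {a} x<a empty =
  sym (below-< empty empty x<a) , sym (notBelow-< empty empty x<a)
insertᴸ-below {x} {a} x<a (node l b r) with b <? a | x <? b
... | yes b<a | yes x<b
  rewrite insertᴸ-< l r x<b | below-< l r b<a | below-< (insertᴸ x l) r b<a
        | notBelow-< l r b<a | notBelow-< (insertᴸ x l) r b<a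
  = insertᴸ-< _ _ x<b , refl
... | yes b<a | no x≮b
  rewrite insertᴸ-≮ l r x≮b | below-< l r b<a | below-< l (insertᴸ x r) b<a
        | notBelow-< l r b<a | notBelow-< l (insertᴸ x r) b<a
  = trans (insertᴸ-≮ _ _ x≮b) (cong (node l b) (proj₁ (insertᴸ-below x<a r))) , proj₂ (insertᴸ-below x<a r)
... | no b≮a | yes x<b
  rewrite insertᴸ-< l r x<b | below-≮ l r b≮a | below-≮ (insertᴸ x l) r b≮a
        | notBelow-≮ l r b≮a | notBelow-≮ (insertᴸ x l) r b≮a
  = proj₁ (insertᴸ-below x<a l) , cong (λ l′ → node l′ b r) (proj₂ (insertᴸ-below x<a l))
... | no b≮a | no x≮b = contradiction (<-≤-trans x<a (≮⇒≥ b≮a)) x≮b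

-- Symmetrically, the two paths part only at a node b with a ≤ b ≤ x, where x enters the right
-- subtree, which `notBelow` keeps whole.
insertᴸ-notBelow : ¬ x < a → ∀ t → below a t ≡ below a (insertᴸ x t)
                                 × insertᴸ x (notBelow a t) ≡ notBelow a (insertᴸ x t)
insertᴸ-notBelow {x} {a} x≮a empty =
  sym (below-≮ empty empty x≮a) , sym (notBelow-≮ empty empty x≮a)
insertᴸ-notBelow {x} {a} x≮a (node l b r) with b <? a | x <? b
... | yes b<a | yes x<b = contradiction (<-trans x<b b<a) x≮a
... | yes b<a | no x≮b
  rewrite insertᴸ-≮ l r x≮b | below-< l r b<a | below-< l (insertᴸ x r) b<a
        | notBelow-< l r b<a | notBelow-< l (insertᴸ x r) b<a
  = cong (node l b) (proj₁ (insertᴸ-notBelow x≮a r)) , proj₂ (insertᴸ-notBelow x≮a r)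
... | no b≮a | yes x<b
  rewrite insertᴸ-< l r x<b | below-≮ l r b≮a | below-≮ (insertᴸ x l) r b≮a
        | notBelow-≮ l r b≮a | notBelow-≮ (insertᴸ x l) r b≮a
  = proj₁ (insertᴸ-notBelow x≮a l)
  , trans (insertᴸ-< _ _ x<b) (cong (λ l′ → node l′ b r) (proj₂ (insertᴸ-notBelow x≮a l)))
... | no b≮a | no x≮b
  rewrite insertᴸ-≮ l r x≮b | below-≮ l r b≮a | below-≮ l (insertᴸ x r) b≮a
        | notBelow-≮ l r b≮a | notBelow-≮ l (insertᴸ x r) b≮a
  = refl , insertᴸ-≮ _ _ x≮b

insertᴸ-insertRoot : ∀ x a t → insertᴸ x (insertRoot a t) ≡ insertRoot a (insertᴸ x t)
insertᴸ-insertRoot x a t with x <? a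
... | yes x<a = let eq , eq′ = insertᴸ-below x<a t in
                trans (insertᴸ-< _ _ x<a) (cong₂ (λ l r → node l a r) eq eq′)
... | no  x≮a = let eq , eq′ = insertᴸ-notBelow x≮a t in
                trans (insertᴸ-≮ _ _ x≮a) (cong₂ (λ l r → node l a r) eq eq′)

-- For `t = empty`, `insertRoot a t` is a single node: leaf insertion of a before w amounts to root
-- insertion of a after w.
foldl-insertRoot : ∀ a t w → foldl (flip insertᴸ) (insertRoot a t) w ≡ insertRoot a (foldl (flip insertᴸ) t w)
foldl-insertRoot a t []      = refl
foldl-insertRoot a t (x ∷ w) =
  trans (cong (λ t′ → foldl (flip insertᴸ) t′ w) (insertᴸ-insertRoot x a t)) (foldl-insertRoot a (insertᴸ x t) w)

split-< : All (_< a) U t → below a t ≡ t × notBelow a t ≡ empty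
split-< {t = empty}      _                = refl , refl
split-< {t = node l b r} (node _ b<a r<a) =
  let eq , eq′ = split-< r<a in trans (below-< l r b<a) (cong (node l b) eq) , trans (notBelow-< l r b<a) eq′

split-≥ : All (a ≤_) U t → below a t ≡ empty × notBelow a t ≡ t
split-≥ {t = empty}      _                = refl , refl
split-≥ {t = node l b r} (node a≤l a≤b _) =
  let eq , eq′ = split-≥ a≤l ; b≮a = ≤⇒≯ a≤b in
  trans (below-≮ l r b≮a) eq , trans (notBelow-≮ l r b≮a) (cong (λ l′ → node l′ b r) eq′)

-- The cut descends the left branch of `t`, whose labels are at least `a`, until it reaches `s`,
-- which lies entirely below `a`.
split-╱ : All (_< a) U s → All (a ≤_) U t → below a (s ╱ t) ≡ s × notBelow a (s ╱ t) ≡ t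
split-╱ {t = empty}      s<a _                = split-< s<a
split-╱ {s = s} {node l b r} s<a (node a≤l a≤b _) =
  let eq , eq′ = split-╱ s<a a≤l ; b≮a = ≤⇒≯ a≤b in
  trans (below-≮ (s ╱ l) r b≮a) eq , trans (notBelow-≮ (s ╱ l) r b≮a) (cong (λ l′ → node l′ b r) eq′)

split-╲ : All (_< a) U s → All (a ≤_) U t → below a (s ╲ t) ≡ s × notBelow a (s ╲ t) ≡ t
split-╲ {s = empty}      _                a≤t = split-≥ a≤t
split-╲ {s = node l b r} {t} (node _ b<a r<a) a≤t =
  let eq , eq′ = split-╲ r<a a≤t in trans (below-< l (r ╲ t) b<a) (cong (node l b) eq) , trans (notBelow-< l (r ╲ t) b<a) eq′

insertRoot-graft : ∀ c → LeftBST (node A a B) → insertRoot a (graft c A B) ≡ node A a B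
insertRoot-graft {a = a} true  (node A<a a≤B _ _) =
  let eq , eq′ = split-╱ A<a a≤B in cong₂ (λ l r → node l a r) eq eq′
insertRoot-graft {a = a} false (node A<a a≤B _ _) =
  let eq , eq′ = split-╲ A<a a≤B in cong₂ (λ l r → node l a r) eq eq′

-- The algorithm seen on T_L alone, with the grafting left free at each step. What is derived from
-- it, namely the left insertion tree and the avoidance of the patterns, holds for all choices.
data Extraction : BinTree Letter → Word → Set where
  []   : Extraction empty []
  step : ∀ c → Extraction (graft c A B) w → Extraction (node A a B) (a ∷ w)

extraction-insertᴸ : LeftBST T → Extraction T w → foldl (flip insertᴸ) empty w ≡ T
extraction-insertᴸ _  []                           = refl
extraction-insertᴸ bT (step {w = w} {a = a} c ext) =
  trans (foldl-insertRoot a empty w)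
        (trans (cong (insertRoot a) (extraction-insertᴸ (leftBST-graft c bT) ext)) (insertRoot-graft c bT))

extraction-↭ : Extraction T w → labels T ↭ w
extraction-↭ []                                      = ↭-reflexive refl
extraction-↭ (step {A = A} {B = B} {a = a} c ext) =
  ↭-trans (shift a (labels A) (labels B))
          (prep a (↭-trans (↭-reflexive (sym (labels-graft c A B))) (extraction-↭ ext)))

-- Avoidance of 2-41-3 and 3-14-2

-- The heap order is that of positions in `w`: ancestors occur before their descendants.
HeapOrdered : BinTree Letter → Word → Set
HeapOrdered empty        w = ⊤
HeapOrdered (node l x r) w =
  (∀ {y} → y ∈ labels l ++ labels r → x ∷ y ∷ [] ⊆ w) × HeapOrdered l w × HeapOrdered r w

heapOrdered-∷ : ∀ t → HeapOrdered t w → HeapOrdered t (a ∷ w)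
heapOrdered-∷ empty        _             = tt
heapOrdered-∷ (node l x r) (x≺ , hl , hr) = (λ y∈ → _ Sublist.∷ʳ x≺ y∈) , heapOrdered-∷ l hl , heapOrdered-∷ r hr

∈-++-map : {xs ys us vs : Word} → (∀ {x} → x ∈ xs → x ∈ us) → (∀ {x} → x ∈ ys → x ∈ vs) →
           ∀ {x} → x ∈ xs ++ ys → x ∈ us ++ vs
∈-++-map {xs} {us = us} f g x∈ with ∈-++⁻ xs x∈
... | inj₁ x∈xs = ∈-++⁺ˡ (f x∈xs)
... | inj₂ x∈ys = ∈-++⁺ʳ us (g x∈ys)

∈-╱ : (s t : BinTree Letter) → x ∈ labels s ++ labels t → x ∈ labels (s ╱ t)
∈-╱ s t = subst (_ ∈_) (sym (labels-╱ s t))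

∈-╲ : (s t : BinTree Letter) → x ∈ labels s ++ labels t → x ∈ labels (s ╲ t)
∈-╲ s t = subst (_ ∈_) (sym (labels-╲ s t))

heapOrdered-╱ : ∀ s t → HeapOrdered (s ╱ t) w → HeapOrdered s w × HeapOrdered t w
heapOrdered-╱ s empty        h              = h , tt
heapOrdered-╱ s (node l x r) (x≺ , hsl , hr) =
  let hs , hl = heapOrdered-╱ s l hsl in
  hs , (λ y∈ → x≺ (∈-++-map (∈-╱ s l ∘ ∈-++⁺ʳ (labels s)) (λ z∈ → z∈) y∈)) , hl , hr

heapOrdered-╲ : ∀ s t → HeapOrdered (s ╲ t) w → HeapOrdered s w × HeapOrdered t w
heapOrdered-╲ empty        t h              = tt , h
heapOrdered-╲ (node l x r) t (x≺ , hl , hrt) =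
  let hr , ht = heapOrdered-╲ r t hrt in
  ((λ y∈ → x≺ (∈-++-map (λ z∈ → z∈) (∈-╲ r t ∘ ∈-++⁺ˡ) y∈)) , hl , hr) , ht

heapOrdered-graft : ∀ c s t → HeapOrdered (graft c s t) w → HeapOrdered s w × HeapOrdered t w
heapOrdered-graft true  = heapOrdered-╱
heapOrdered-graft false = heapOrdered-╲

-- The root is written first, and a grafting keeps all ancestor relations inside A and inside B.
extraction-heapOrdered : Extraction T w → HeapOrdered T w
extraction-heapOrdered []                              = tt
extraction-heapOrdered (step {A = A} {B = B} {w = w} c ext) =
  let hA , hB = heapOrdered-graft c A B (extraction-heapOrdered ext) in
  (λ y∈ → refl ∷ from∈ (∈-resp-↭ (extraction-↭ ext) (subst (_ ∈_) (sym (labels-graft c A B)) y∈)))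
  , heapOrdered-∷ A hA , heapOrdered-∷ B hB

-- The right branch of `s` lies above all of `t`. The node y is the one where the path to x leaves
-- this branch or ends on it, so that x is y or lies to its left.
╲-ancestor : LeftBST s → HeapOrdered (s ╲ t) w → x ∈ labels s → d ∈ labels t →
             ∃[ y ] (y ∈ labels s × x ≤ y × y ∷ d ∷ [] ⊆ w)
╲-ancestor {s = node l z r} {t} (node l<z _ _ br) (z≺ , _ , h) x∈ d∈ with ∈-++⁻ (labels l) x∈
... | inj₁ x∈l         = z , ∈-insert (labels l) , <⇒≤ (lookup-labels l<z x∈l)
                       , z≺ (∈-++⁺ʳ (labels l) (∈-╲ r t (∈-++⁺ʳ (labels r) d∈)))
... | inj₂ (here refl) = z , ∈-insert (labels l) , ≤-refl
                       , z≺ (∈-++⁺ʳ (labels l) (∈-╲ r t (∈-++⁺ʳ (labels r) d∈)))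
... | inj₂ (there x∈r) = let y , y∈ , x≤y , y≺d = ╲-ancestor br h x∈r d∈ in
                         y , ∈-++⁺ʳ (labels l) (there y∈) , x≤y , y≺d

-- Likewise the left branch of `t` lies above all of `s`, and x is y or lies to its right.
╱-ancestor : LeftBST t → HeapOrdered (s ╱ t) w → x ∈ labels t → a ∈ labels s →
             ∃[ y ] (y ∈ labels t × y ≤ x × y ∷ a ∷ [] ⊆ w)
╱-ancestor {t = node l z r} {s} (node _ z≤r bl _) (z≺ , h , _) x∈ a∈ with ∈-++⁻ (labels l) x∈
... | inj₁ x∈l         = let y , y∈ , y≤x , y≺a = ╱-ancestor bl h x∈l a∈ in
                         y , ∈-++⁺ˡ y∈ , y≤x , y≺a
... | inj₂ (here refl) = z , ∈-insert (labels l) , ≤-refl , z≺ (∈-++⁺ˡ (∈-╱ s l (∈-++⁺ˡ a∈)))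
... | inj₂ (there x∈r) = z , ∈-insert (labels l) , lookup-labels z≤r x∈r
                       , z≺ (∈-++⁺ˡ (∈-╱ s l (∈-++⁺ˡ a∈)))

unique⇒disjoint : ∀ xs {ys : Word} → Unique (xs ++ ys) → x ∈ xs → x ∈ ys → ⊥
unique⇒disjoint (_ ∷ xs) (x# ∷ _) (here refl) x∈ys = ListAll.lookup x# (∈-++⁺ʳ xs x∈ys) refl
unique⇒disjoint (_ ∷ xs) (_ ∷ un) (there x∈)  x∈ys = unique⇒disjoint xs un x∈ x∈ys

unique-⊆⇒∈ : ∀ q {v} → Unique (q ++ d ∷ v) → x ∷ d ∷ [] ⊆ q ++ d ∷ v → x ∈ q
unique-⊆⇒∈ []      un (_ ∷ s)    = contradiction (Sublist.lookup s (here refl)) (Unique[x∷xs]⇒x∉xs un)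
unique-⊆⇒∈ []      un (_ Sublist.∷ʳ s)   = contradiction (Sublist.lookup s (there (here refl))) (Unique[x∷xs]⇒x∉xs un)
unique-⊆⇒∈ (_ ∷ q) _  (refl ∷ _) = here refl
unique-⊆⇒∈ (_ ∷ q) (_ ∷ un) (_ Sublist.∷ʳ s) = there (unique-⊆⇒∈ q un s)

-- This is where the adjacency of the two middle letters of a pattern enters: the only place before
-- d and outside `q` is that of c.
unique-⊆-adjacent⇒∈ : ∀ q {v} → Unique (q ++ c ∷ d ∷ v) → x ∷ d ∷ [] ⊆ q ++ c ∷ d ∷ v → x ≢ c → x ∈ q
unique-⊆-adjacent⇒∈ {c} {d} {x} q {v} un s x≢c
  with ∈-++⁻ q (unique-⊆⇒∈ (q ∷ʳ c) (subst Unique eq un) (subst (x ∷ d ∷ [] ⊆_) eq s))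
  where
  eq : q ++ c ∷ d ∷ v ≡ (q ∷ʳ c) ++ d ∷ v
  eq = sym (++-assoc q [ c ] (d ∷ v))
... | inj₁ x∈q        = x∈q
... | inj₂ (here x≡c) = contradiction x≡c x≢c

∈-labels⁻-< : LeftBST (node A a B) → x ∈ labels A ++ labels B → x < a → x ∈ labels A
∈-labels⁻-< {A = A} (node _ a≤B _ _) x∈ x<a with ∈-++⁻ (labels A) x∈
... | inj₁ x∈A = x∈A
... | inj₂ x∈B = contradiction x<a (≤⇒≯ (lookup-labels a≤B x∈B))

∈-labels⁻-≥ : LeftBST (node A a B) → x ∈ labels A ++ labels B → a ≤ x → x ∈ labels B
∈-labels⁻-≥ {A = A} (node A<a _ _ _) x∈ a≤x with ∈-++⁻ (labels A) x∈
... | inj₁ x∈A = contradiction (lookup-labels A<a x∈A) (≤⇒≯ a≤x)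
... | inj₂ x∈B = x∈B

extraction-∈ : ∀ c A B → Extraction (graft c A B) w → x ∈ w → x ∈ labels A ++ labels B
extraction-∈ c A B ext x∈ = subst (_ ∈_) (labels-graft c A B) (∈-resp-↭ (↭-sym (extraction-↭ ext)) x∈)

≤∧∈∧∉⇒< : ∀ {q : Word} → x ≤ y → x ∉ q → y ∈ q → x < y
≤∧∈∧∉⇒< x≤y x∉q y∈q = ≤∧≢⇒< x≤y λ { refl → x∉q y∈q }

≥∧∈∧∉⇒> : ∀ {q : Word} → y ≤ x → x ∉ q → y ∈ q → y < x
≥∧∈∧∉⇒> y≤x x∉q y∈q = ≤∧≢⇒< y≤x λ { refl → x∉q y∈q }

-- Induction on the extraction stands in for the choice of the last b. It first descends to the step
-- that extracts b; a later candidate y is then excluded by the remaining extraction.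
extraction-avoids-2413 :
  LeftBST T → Extraction T w → Unique w → ∀ p q r →
  w ≡ p ++ b ∷ q ++ d ∷ a ∷ r → c ∈ r → a < b → b < c → c < d → ⊥
extraction-avoids-2413 bT (step e ext) (_ ∷ un) (_ ∷ p) q r refl =
  extraction-avoids-2413 (leftBST-graft e bT) ext un p q r refl
extraction-avoids-2413 {b = b} {d} {a} {c} bT@(node A<b b≤B bA bB) (step {A = A} {B = B} e ext) (_ ∷ un) [] q r refl c∈r a<b b<c c<d =
  go e (leftBST-graft e bT) ext
  where
  a∉q : a ∉ q
  a∉q a∈q = unique⇒disjoint q un a∈q (there (here refl))
  c∉q : c ∉ q
  c∉q c∈q = unique⇒disjoint q un c∈q (there (there c∈r))
  a∈w : a ∈ q ++ d ∷ a ∷ r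
  a∈w = ∈-++⁺ʳ q (there (here refl))
  c∈w : c ∈ q ++ d ∷ a ∷ r
  c∈w = ∈-++⁺ʳ q (there (there c∈r))
  d∈w : d ∈ q ++ d ∷ a ∷ r
  d∈w = ∈-++⁺ʳ q (here refl)
  -- y is a later choice for b
  retry : ∀ e → LeftBST (graft e A B) → Extraction (graft e A B) (q ++ d ∷ a ∷ r) →
          y ∈ q → a < y → y < c → ⊥
  retry e bT′ ext y∈q a<y y<c =
    let q₁ , q₂ , eq = ∈-∃++ y∈q in
    extraction-avoids-2413 bT′ ext un q₁ q₂ r
      (trans (cong (_++ d ∷ a ∷ r) eq) (++-assoc q₁ (_ ∷ q₂) (d ∷ a ∷ r))) c∈r a<y y<c c<d
  go : ∀ e → LeftBST (graft e A B) → Extraction (graft e A B) (q ++ d ∷ a ∷ r) → ⊥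
  go false bT′ ext =
    let y , y∈A , a≤y , y≺d = ╲-ancestor bA (extraction-heapOrdered ext)
          (∈-labels⁻-< bT (extraction-∈ false A B ext a∈w) a<b)
          (∈-labels⁻-≥ bT (extraction-∈ false A B ext d∈w) (<⇒≤ (<-trans b<c c<d)))
        y∈q = unique-⊆⇒∈ q un y≺d
    in retry false bT′ ext y∈q (≤∧∈∧∉⇒< a≤y a∉q y∈q) (<-trans (lookup-labels A<b y∈A) b<c)
  go true bT′ ext =
    let y , y∈B , y≤c , y≺a = ╱-ancestor bB (extraction-heapOrdered ext)
          (∈-labels⁻-≥ bT (extraction-∈ true A B ext c∈w) (<⇒≤ b<c))
          (∈-labels⁻-< bT (extraction-∈ true A B ext a∈w) a<b)
        -- The ancestor y precedes a; as y ≤ c < d it is not d, so it also precedes d.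
        y∈q = unique-⊆-adjacent⇒∈ q un y≺a (<⇒≢ (≤-<-trans y≤c c<d))
    in retry true bT′ ext y∈q (<-≤-trans a<b (lookup-labels b≤B y∈B)) (≥∧∈∧∉⇒> y≤c c∉q y∈q)

-- The letter replaced is now c: `╲` yields y in A above d with b ≤ y < c, and `╱` yields y in B
-- above a with c ≤ y ≤ d.
extraction-avoids-3142 :
  LeftBST T → Extraction T w → Unique w → ∀ p q r →
  w ≡ p ++ c ∷ q ++ a ∷ d ∷ r → b ∈ r → a < b → b < c → c < d → ⊥
extraction-avoids-3142 bT (step e ext) (_ ∷ un) (_ ∷ p) q r refl =
  extraction-avoids-3142 (leftBST-graft e bT) ext un p q r refl
extraction-avoids-3142 {c = c} {a} {d} {b} bT@(node A<c c≤B bA bB) (step {A = A} {B = B} e ext) (_ ∷ un) [] q r refl b∈r a<b b<c c<d =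
  go e (leftBST-graft e bT) ext
  where
  d∉q : d ∉ q
  d∉q d∈q = unique⇒disjoint q un d∈q (there (here refl))
  b∉q : b ∉ q
  b∉q b∈q = unique⇒disjoint q un b∈q (there (there b∈r))
  a∈w : a ∈ q ++ a ∷ d ∷ r
  a∈w = ∈-++⁺ʳ q (here refl)
  b∈w : b ∈ q ++ a ∷ d ∷ r
  b∈w = ∈-++⁺ʳ q (there (there b∈r))
  d∈w : d ∈ q ++ a ∷ d ∷ r
  d∈w = ∈-++⁺ʳ q (there (here refl))
  -- y is a later choice for c
  retry : ∀ e → LeftBST (graft e A B) → Extraction (graft e A B) (q ++ a ∷ d ∷ r) →
          y ∈ q → b < y → y < d → ⊥
  retry e bT′ ext y∈q b<y y<d =
    let q₁ , q₂ , eq = ∈-∃++ y∈q in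
    extraction-avoids-3142 bT′ ext un q₁ q₂ r
      (trans (cong (_++ a ∷ d ∷ r) eq) (++-assoc q₁ (_ ∷ q₂) (a ∷ d ∷ r))) b∈r a<b b<y y<d
  go : ∀ e → LeftBST (graft e A B) → Extraction (graft e A B) (q ++ a ∷ d ∷ r) → ⊥
  go false bT′ ext =
    let y , y∈A , b≤y , y≺d = ╲-ancestor bA (extraction-heapOrdered ext)
          (∈-labels⁻-< bT (extraction-∈ false A B ext b∈w) b<c)
          (∈-labels⁻-≥ bT (extraction-∈ false A B ext d∈w) (<⇒≤ c<d))
        -- As a < b ≤ y, the ancestor y is not a, so it precedes both a and d.
        y∈q = unique-⊆-adjacent⇒∈ q un y≺d (>⇒≢ (<-≤-trans a<b b≤y))
    in retry false bT′ ext y∈q (≤∧∈∧∉⇒< b≤y b∉q y∈q) (<-trans (lookup-labels A<c y∈A) c<d)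
  go true bT′ ext =
    let y , y∈B , y≤d , y≺a = ╱-ancestor bB (extraction-heapOrdered ext)
          (∈-labels⁻-≥ bT (extraction-∈ true A B ext d∈w) (<⇒≤ c<d))
          (∈-labels⁻-< bT (extraction-∈ true A B ext a∈w) (<-trans a<b b<c))
        y∈q = unique-⊆⇒∈ q un y≺a
    in retry true bT′ ext y∈q (<-≤-trans b<c (lookup-labels c≤B y∈B)) (≥∧∈∧∉⇒> y≤d d∉q y∈q)

-- Standardization

filter-empty⁻ : {P : Pred Letter 0ℓ} (P? : Unary.Decidable P) (xs : Word) → length (filter P? xs) ≡ 0 → ListAll.All (∁ P) xs
filter-empty⁻ P? xs eq = ListAllₚ.¬Any⇒All¬ xs λ any → <⇒≢ (filter-some P? any) (sym eq)

filter-full⁻ : {P : Pred Letter 0ℓ} (P? : Unary.Decidable P) (xs : Word) → length (filter P? xs) ≡ length xs → ListAll.All P xs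
filter-full⁻ P? xs eq = subst (ListAll.All _) (filter-complete P? eq) (ListAllₚ.all-filter P? xs)

-- An entry of a standardization that equals the length of the word counts all other letters, so
-- both of its counts are full.
+-≤-full : ∀ {m n j k} → m ≤ j → n ≤ k → m + n ≡ j + k → m ≡ j × n ≡ k
+-≤-full {m} {n} {j} {k} m≤j n≤k eq =
    ≤-antisym m≤j (+-cancelʳ-≤ k j m (≤-trans (≤-reflexive (sym eq)) (+-monoʳ-≤ m n≤k)))
  , ≤-antisym n≤k (+-cancelˡ-≤ j k n (≤-trans (≤-reflexive (sym eq)) (+-monoˡ-≤ n m≤j)))

module _ {u₁ u₂ u₃ u₄ : Letter} where

  -- The entries 4 and 1 compare `u₂` and `u₃` with all other letters. By the entry 2 only one later
  -- letter is below `u₁`; this is `u₃`, hence not `u₄`.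
  standardize-2413 : standardize (u₁ ∷ u₂ ∷ u₃ ∷ u₄ ∷ []) ≡ 2 ∷ 4 ∷ 1 ∷ 3 ∷ [] →
                     u₃ < u₁ × u₁ ≤ u₄ × u₄ < u₂
  standardize-2413 eq
    with eq₁ , eq′ ← ∷-injective eq
    with eq₂ , eq″ ← ∷-injective eq′
    with eq₃       ← ∷-injectiveˡ eq″
    with e , e′ ← +-≤-full (length-filter (_≤? u₂) (u₁ ∷ [])) (length-filter (_<? u₂) (u₃ ∷ u₄ ∷ [])) (suc-injective eq₂)
    with u₁≤u₂ ListAll.∷ _           ← filter-full⁻ (_≤? u₂) (u₁ ∷ []) e
    with _ ListAll.∷ u₄<u₂ ListAll.∷ _  ← filter-full⁻ (_<? u₂) (u₃ ∷ u₄ ∷ []) e′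
    with _ ListAll.∷ u₁≰u₃ ListAll.∷ _  ← filter-empty⁻ (_≤? u₃) (u₂ ∷ u₁ ∷ []) (m+n≡0⇒m≡0 _ (suc-injective eq₃))
    = ≰⇒> u₁≰u₃ , ≮⇒≥ u₄≮u₁ , u₄<u₂
    where
    u₄≮u₁ : ¬ u₄ < u₁
    u₄≮u₁ u₄<u₁ = contradiction
      (trans (sym (cong length (trans (filter-reject (_<? u₁) (≤⇒≯ u₁≤u₂))
                                      (filter-all (_<? u₁) (≰⇒> u₁≰u₃ ListAll.∷ u₄<u₁ ListAll.∷ ListAll.[])))))
             (suc-injective eq₁))
      λ ()

  -- By the entry 3 two later letters are below `u₁`; since `u₁ ≤ u₃`, one of them is `u₄`.
  standardize-3142 : standardize (u₁ ∷ u₂ ∷ u₃ ∷ u₄ ∷ []) ≡ 3 ∷ 1 ∷ 4 ∷ 2 ∷ [] →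
                     u₂ ≤ u₄ × u₄ < u₁ × u₁ ≤ u₃
  standardize-3142 eq
    with eq₁ , eq′ ← ∷-injective eq
    with eq₂ , eq″ ← ∷-injective eq′
    with eq₃       ← ∷-injectiveˡ eq″
    with e , e′ ← +-≤-full (length-filter (_≤? u₃) (u₂ ∷ u₁ ∷ [])) (length-filter (_<? u₃) (u₄ ∷ [])) (suc-injective eq₃)
    with _ ListAll.∷ u₁≤u₃ ListAll.∷ _  ← filter-full⁻ (_≤? u₃) (u₂ ∷ u₁ ∷ []) e
    with u₁≰u₂ ListAll.∷ _           ← filter-empty⁻ (_≤? u₂) (u₁ ∷ []) (m+n≡0⇒m≡0 _ (suc-injective eq₂))
    with _ ListAll.∷ u₄≮u₂ ListAll.∷ _  ← filter-empty⁻ (_<? u₂) (u₃ ∷ u₄ ∷ []) (m+n≡0⇒n≡0 (length (filter (_≤? u₂) (u₁ ∷ []))) (suc-injective eq₂))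
    = ≮⇒≥ u₄≮u₂ , ≰⇒> u₁≰u₄ , u₁≤u₃
    where
    u₁≰u₄ : ¬ u₁ ≤ u₄
    u₁≰u₄ u₁≤u₄ = contradiction
      (trans (sym (cong length (trans (filter-accept (_<? u₁) (≰⇒> u₁≰u₂))
                                      (cong (u₂ ∷_) (filter-none (_<? u₁) (≤⇒≯ u₁≤u₃ ListAll.∷ ≤⇒≯ u₁≤u₄ ListAll.∷ ListAll.[]))))))
             (suc-injective eq₁))
      λ ()

unique⇒≢ : ∀ p {q} → Unique (p ++ x ∷ q) → y ∈ q → x ≢ y
unique⇒≢ []      (x# ∷ _) y∈q = ListAll.lookup x# y∈q
unique⇒≢ (_ ∷ p) (_ ∷ un) y∈q = unique⇒≢ p un y∈q

-- Standardization tolerates equal letters; those of a permutation are distinct, which makes the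
-- weak inequalities strict.
extraction-baxter : LeftBST T → Extraction T w → IsPermutation w → IsBaxterPermutation w
extraction-baxter {T} {w} bT ext perm = record
  { isPermutation = perm
  ; avoids        = λ p q r s {u₁} {u₂} {u₃} {u₄} eq →
      let u₁# : ∀ {y} → y ∈ q ++ u₂ ∷ u₃ ∷ r ++ u₄ ∷ s → u₁ ≢ y
          u₁# = unique⇒≢ p (subst Unique eq unique)
          eq′ = trans eq (sym (++-assoc p (u₁ ∷ q) (u₂ ∷ u₃ ∷ r ++ u₄ ∷ s)))
          u₂# : ∀ {y} → y ∈ u₃ ∷ r ++ u₄ ∷ s → u₂ ≢ y
          u₂# = unique⇒≢ (p ++ u₁ ∷ q) (subst Unique eq′ unique)
          u₄∈ : u₄ ∈ r ++ u₄ ∷ s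
          u₄∈ = ∈-insert r
      in (λ std → let u₃<u₁ , u₁≤u₄ , u₄<u₂ = standardize-2413 std in
            extraction-avoids-2413 bT ext unique p q (r ++ u₄ ∷ s) eq u₄∈
              u₃<u₁ (≤∧≢⇒< u₁≤u₄ (u₁# (∈-++⁺ʳ q (there (there u₄∈))))) u₄<u₂)
       , (λ std → let u₂≤u₄ , u₄<u₁ , u₁≤u₃ = standardize-3142 std in
            extraction-avoids-3142 bT ext unique p q (r ++ u₄ ∷ s) eq u₄∈
              (≤∧≢⇒< u₂≤u₄ (u₂# (there u₄∈))) u₄<u₁ (≤∧≢⇒< u₁≤u₃ (u₁# (∈-++⁺ʳ q (there (here refl))))))
  }
  where
  unique : Unique w
  unique = Unique-resp-↭ (↭⇒↭ₛ (↭-sym perm))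
             (applyUpTo⁺₁ suc (length w) λ i<j _ eq → <⇒≢ i<j (suc-injective eq))

-- Suppression of a childless node

bit : Bool → Bit
bit true  = 1b
bit false = 0b

-- The Boolean σ tells whether t is a left subtree, and c whether the suppressed node is a left child.
data Prune {N : Set} (a : N) : (σ : Bool) (i : ℕ) (t t′ : BinTree N) (c : Bool) → Set where
  here  : ∀ {σ} → Prune a σ 0 (node empty a empty) empty σ
  left  : ∀ {σ i l l′ b r c} → Prune a true i l l′ c → Prune a σ i (node l b r) (node l′ b r) c
  right : ∀ {σ i l b r r′ c} → Prune a false i r r′ c →
          Prune a σ (suc (#nodes l + i)) (node l b r) (node l b r′) c

module _ {N : Set} {a : N} where

  prune-< : ∀ {σ i t t′ c} → Prune a σ i t t′ c → i < #nodes t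
  prune-< here              = s≤s z≤n
  prune-< (left p)          = <-≤-trans (prune-< p) (m≤m+n _ _)
  prune-< (right {i = i} {l} {r = r} p) =
    <-≤-trans (s≤s (+-monoʳ-< (#nodes l) (prune-< p))) (≤-reflexive (sym (+-suc (#nodes l) (#nodes r))))

  prune-suppress : ∀ {σ i t t′ c} → Prune a σ i t t′ c → suppress i t ≡ just t′
  prune-suppress here = refl
  prune-suppress (left {i = i} {l} p) with <-cmp i (#nodes l)
  ... | tri< _ _ _   = cong (Maybe.map _) (prune-suppress p)
  ... | tri≈ i≮l _ _ = contradiction (prune-< p) i≮l
  ... | tri> i≮l _ _ = contradiction (prune-< p) i≮l
  prune-suppress (right {i = i} {l} p) with <-cmp (suc (#nodes l + i)) (#nodes l)
  ... | tri< _ _ i≯l = contradiction (s≤s (m≤m+n (#nodes l) i)) i≯l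
  ... | tri≈ _ _ i≯l = contradiction (s≤s (m≤m+n (#nodes l) i)) i≯l
  ... | tri> _ _ _ rewrite m+n∸m≡n (#nodes l) i = cong (Maybe.map _) (prune-suppress p)

  prune-isLeftChildIn : ∀ {σ i t t′ c} → Prune a σ i t t′ c → isLeftChildIn σ i t ≡ c
  prune-isLeftChildIn here = refl
  prune-isLeftChildIn (left {i = i} {l} p) with <-cmp i (#nodes l)
  ... | tri< _ _ _   = prune-isLeftChildIn p
  ... | tri≈ i≮l _ _ = contradiction (prune-< p) i≮l
  ... | tri> i≮l _ _ = contradiction (prune-< p) i≮l
  prune-isLeftChildIn (right {i = i} {l} p) with <-cmp (suc (#nodes l + i)) (#nodes l)
  ... | tri< _ _ i≯l = contradiction (s≤s (m≤m+n (#nodes l) i)) i≯l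
  ... | tri≈ _ _ i≯l = contradiction (s≤s (m≤m+n (#nodes l) i)) i≯l
  ... | tri> _ _ _ rewrite m+n∸m≡n (#nodes l) i = prune-isLeftChildIn p

  prune-labels : ∀ {σ i t t′ c} → Prune a σ i t t′ c →
                 ∃[ xs ] ∃[ ys ] (length xs ≡ i × labels t ≡ xs ++ a ∷ ys × labels t′ ≡ xs ++ ys)
  prune-labels here = [] , [] , refl , refl , refl
  prune-labels (left {b = b} {r} p) =
    let xs , ys , len , eq , eq′ = prune-labels p in
    xs , ys ++ b ∷ labels r , len
    , trans (cong (_++ b ∷ labels r) eq) (++-assoc xs (a ∷ ys) (b ∷ labels r))
    , trans (cong (_++ b ∷ labels r) eq′) (++-assoc xs ys (b ∷ labels r))
  prune-labels (right {l = l} {b} p) =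
    let xs , ys , len , eq , eq′ = prune-labels p in
    labels l ++ b ∷ xs , ys
    , trans (length-++ (labels l))
            (trans (+-suc _ (length xs)) (cong suc (cong₂ _+_ (length-labels l) len)))
    , trans (cong (λ zs → labels l ++ b ∷ zs) eq) (sym (++-assoc (labels l) (b ∷ xs) (a ∷ ys)))
    , trans (cong (λ zs → labels l ++ b ∷ zs) eq′) (sym (++-assoc (labels l) (b ∷ xs) ys))

  prune-All : ∀ {P : Pred N 0ℓ} {σ i t t′ c} → Prune a σ i t t′ c → All P U t → P a × All P U t′
  prune-All here      (node _ pa _)    = pa , leaf tt
  prune-All (left p)  (node pl pb pr) = let pa , pl′ = prune-All p pl in pa , node pl′ pb pr
  prune-All (right p) (node pl pb pr) = let pa , pr′ = prune-All p pr in pa , node pl pb pr′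

prune-rightBST : ∀ {σ i c} → Prune a σ i t T c → RightBST t → RightBST T
prune-rightBST here      _                   = leaf
prune-rightBST (left p)  (node l≤b b<r bl br) = node (proj₂ (prune-All p l≤b)) b<r (prune-rightBST p bl) br
prune-rightBST (right p) (node l≤b b<r bl br) = node l≤b (proj₂ (prune-All p b<r)) bl (prune-rightBST p br)

-- The search conditions at the ancestors of the removed node are the tests of `insertᴿ`, so they
-- lead `a` back to its old place.
prune-insertᴿ : ∀ {σ i c} → Prune a σ i t T c → RightBST t → insertᴿ a T ≡ t
prune-insertᴿ here _ = refl
prune-insertᴿ {a} (left {l′ = l′} {b} {r} p) (node l≤b _ bl _) = begin
  insertᴿ a (node l′ b r)  ≡⟨ cong (λ e → if e then node (insertᴿ a l′) b r else node l′ b (insertᴿ a r))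
                                   (dec-true (a ≤? b) (proj₁ (prune-All p l≤b))) ⟩
  node (insertᴿ a l′) b r  ≡⟨ cong (λ l → node l b r) (prune-insertᴿ p bl) ⟩
  node _ b r               ∎
  where open ≡-Reasoning
prune-insertᴿ {a} (right {l = l} {b} {r′ = r′} p) (node _ b<r _ br) = begin
  insertᴿ a (node l b r′)  ≡⟨ cong (λ e → if e then node (insertᴿ a l) b r′ else node l b (insertᴿ a r′))
                                   (dec-false (a ≤? b) (<⇒≱ (proj₁ (prune-All p b<r)))) ⟩
  node l b (insertᴿ a r′)  ≡⟨ cong (node l b) (prune-insertᴿ p br) ⟩
  node l b _               ∎
  where open ≡-Reasoning

-- Leaves and canopies

-- Serves to locate two neighbouring leaves: both in the left subtree, on either side of the root,
-- or both in the right subtree.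
split-adjacent : ∀ {X : Set} {p q : X} us {vs} xs {ys} → us ++ vs ≡ xs ++ p ∷ q ∷ ys →
  (∃[ zs ] (us ≡ xs ++ p ∷ q ∷ zs × ys ≡ zs ++ vs))
  ⊎ (us ≡ xs ∷ʳ p × vs ≡ q ∷ ys)
  ⊎ (∃[ zs ] (xs ≡ us ++ zs × vs ≡ zs ++ p ∷ q ∷ ys))
split-adjacent []            xs       eq   = inj₂ (inj₂ (xs , refl , eq))
split-adjacent (_ ∷ [])      []       refl = inj₂ (inj₁ (refl , refl))
split-adjacent (_ ∷ _ ∷ us)  []       refl = inj₁ (us , refl , refl)
split-adjacent (_ ∷ us) (_ ∷ xs) eq with refl , eq′ ← ∷-injective eq | split-adjacent us xs (∷-injectiveʳ eq)
... | inj₁ (zs , eq₁ , eq₂)        = inj₁ (zs , cong (_ ∷_) eq₁ , eq₂)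
... | inj₂ (inj₁ (eq₁ , eq₂))      = inj₂ (inj₁ (cong (_ ∷_) eq₁ , eq₂))
... | inj₂ (inj₂ (zs , eq₁ , eq₂)) = inj₂ (inj₂ (zs , cong (_ ∷_) eq₁ , eq₂))

length-leafBits : ∀ σ (t : BinTree N) → length (leafBits σ t) ≡ suc (#nodes t)
length-leafBits σ empty        = refl
length-leafBits σ (node l _ r) =
  trans (length-++ (leafBits 1b l)) (cong₂ _+_ (length-leafBits 1b l) (length-leafBits 0b r))

-- The leaves of `s` replace the first leaf of `t`. Passing down the bit 1 makes that leaf a 1 even
-- for empty `t`.
leafBits-╱ : (s t : BinTree N) →
  ∃[ K ] (leafBits 1b t ≡ 1b ∷ K × leafBits 1b (s ╱ t) ≡ leafBits 1b s ++ K)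
leafBits-╱ s empty        = [] , refl , sym (++-identityʳ _)
leafBits-╱ s (node l _ r) =
  let K , eq , eq′ = leafBits-╱ s l in
  K ++ leafBits 0b r , cong (_++ leafBits 0b r) eq
  , trans (cong (_++ leafBits 0b r) eq′) (++-assoc (leafBits 1b s) K (leafBits 0b r))

leafBits-╲ : (s t : BinTree N) →
  ∃[ K ] (leafBits 0b s ≡ K ∷ʳ 0b × leafBits 0b (s ╲ t) ≡ K ++ leafBits 0b t)
leafBits-╲ empty        t = [] , refl , refl
leafBits-╲ (node l _ r) t =
  let K , eq , eq′ = leafBits-╲ r t in
  leafBits 1b l ++ K , trans (cong (leafBits 1b l ++_) eq) (sym (++-assoc (leafBits 1b l) K [ 0b ]))
  , trans (cong (leafBits 1b l ++_) eq′) (sym (++-assoc (leafBits 1b l) K (leafBits 0b t)))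

leafBits-ends : ∀ (l : BinTree N) x r → ∃[ K ] ∀ σ → leafBits σ (node l x r) ≡ 1b ∷ K ∷ʳ 0b
leafBits-ends l x r =
  -- These calls provide the first bit of `l` and the last bit of `r`; the tree grafted is a filler.
  let K , eq , _ = leafBits-╱ l l ; L , eq′ , _ = leafBits-╲ r r in
  K ++ L , λ _ → trans (cong₂ _++_ eq eq′) (sym (++-assoc (1b ∷ K) L [ 0b ]))

take-length-++ : ∀ {X : Set} (xs {ys} : List X) → take (length xs) (xs ++ ys) ≡ xs
take-length-++ []       = refl
take-length-++ (x ∷ xs) = cong (x ∷_) (take-length-++ xs)

length-∷-∷ʳ : ∀ {σ p q K} (t : BinTree N) → leafBits σ t ≡ p ∷ K ∷ʳ q → #nodes t ≡ suc (length K)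
length-∷-∷ʳ {σ = σ} {K = K} t eq =
  suc-injective (trans (sym (length-leafBits σ t))
    (trans (cong length eq) (cong suc (trans (length-++ K) (+-comm (length K) 1)))))

canopy-leafBits : ∀ {p q K} (t : BinTree N) → leafBits 0b t ≡ p ∷ K ∷ʳ q → canopy t ≡ K
canopy-leafBits {K = K} t eq rewrite eq | length-∷-∷ʳ t eq = take-length-++ K

[x]≢++∷∷ : ∀ {X : Set} {p q x : X} xs {ys} → x ∷ [] ≢ xs ++ p ∷ q ∷ ys
[x]≢++∷∷ []          ()
[x]≢++∷∷ (_ ∷ [])    ()
[x]≢++∷∷ (_ ∷ _ ∷ _) ()

-- The last leaf of a nonempty tree is a right child, so a final 1 can only be the bit passed down
-- to a lone leaf.
leafBits-≡∷ʳ1b : ∀ {K} (t : BinTree N) → leafBits 1b t ≡ K ∷ʳ 1b → t ≡ empty × K ≡ []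
leafBits-≡∷ʳ1b {K = []}        empty        _  = refl , refl
leafBits-≡∷ʳ1b {K = _ ∷ []}    empty        ()
leafBits-≡∷ʳ1b {K = _ ∷ _ ∷ _} empty        ()
leafBits-≡∷ʳ1b {K = K}         (node l x r) eq with leafBits-ends l x r
... | L , ends with () ← ∷ʳ-injectiveʳ K (1b ∷ L) (trans (sym eq) (ends 1b))

leafBits-≡0b∷ : ∀ {K} (t : BinTree N) → leafBits 0b t ≡ 0b ∷ K → t ≡ empty × K ≡ []
leafBits-≡0b∷ empty        refl = refl , refl
leafBits-≡0b∷ (node l x r) eq with leafBits-ends l x r
... | L , ends with () ← trans (sym eq) (ends 0b)

-- A node between a left leaf and a right leaf has no child.
prune-leafBits : ∀ σ (t : BinTree N) X {Y} → leafBits (bit σ) t ≡ X ++ 1b ∷ 0b ∷ Y →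
  ∃[ a ] ∃[ t′ ] ∃[ c ] (Prune a σ (length X) t t′ c × leafBits (bit σ) t′ ≡ X ++ bit c ∷ Y)
prune-leafBits σ empty        X eq = contradiction eq ([x]≢++∷∷ X)
prune-leafBits σ (node l b r) X eq with split-adjacent (leafBits 1b l) X eq
... | inj₁ (Z , eq₁ , refl) =
  let a , l′ , c , p , eq′ = prune-leafBits true l X eq₁ in
  a , node l′ b r , c , left p
  , trans (cong (_++ leafBits 0b r) eq′) (++-assoc X (bit c ∷ Z) (leafBits 0b r))
-- The bits 1 and 0 on either side of the root force both subtrees to be empty: the root itself is
-- suppressed.
... | inj₂ (inj₁ (eq₁ , eq₂)) with refl , refl ← leafBits-≡∷ʳ1b l eq₁ | refl , refl ← leafBits-≡0b∷ r eq₂ =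
  b , empty , σ , here , refl
... | inj₂ (inj₂ (Z , refl , eq₂)) =
  let a , r′ , c , p , eq′ = prune-leafBits false r Z eq₂ in
  a , node l b r′ , c
  -- `X` consists of the leaves of `l`, one more than its nodes, and of `Z`; the extra leaf accounts
  -- for the root in the index.
  , subst (λ i → Prune a σ i (node l b r) (node l b r′) c)
          (sym (trans (length-++ (leafBits 1b l)) (cong (_+ length Z) (length-leafBits 1b l)))) (right p)
  , trans (cong (leafBits 1b l ++_) eq′) (sym (++-assoc (leafBits 1b l) Z (bit c ∷ _)))

pointwise-++⁻ : ∀ {X : Set} {R : X → X → Set} us {vs ws} → Pointwise R (us ++ vs) ws →
  ∃[ xs ] ∃[ ys ] (ws ≡ xs ++ ys × Pointwise R us xs × Pointwise R vs ys)
pointwise-++⁻ []       rs       = [] , _ , refl , [] , rs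
pointwise-++⁻ (_ ∷ us) (r ∷ rs) =
  let xs , ys , eq , rs₁ , rs₂ = pointwise-++⁻ us rs in
  _ ∷ xs , ys , cong (_ ∷_) eq , r ∷ rs₁ , rs₂

≢0b⇒1b : {p : Bit} → 0b ≢ p → p ≡ 1b
≢0b⇒1b {Fin.zero}         0≢p = contradiction refl 0≢p
≢0b⇒1b {Fin.suc Fin.zero} _   = refl

≢1b⇒0b : {p : Bit} → 1b ≢ p → p ≡ 0b
≢1b⇒0b {Fin.zero}         _   = refl
≢1b⇒0b {Fin.suc Fin.zero} 1≢p = contradiction refl 1≢p

╱-identityˡ : (t : BinTree N) → empty ╱ t ≡ t
╱-identityˡ empty        = refl
╱-identityˡ (node l x r) = cong (λ l′ → node l′ x r) (╱-identityˡ l)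

╲-identityʳ : (t : BinTree N) → t ╲ empty ≡ t
╲-identityʳ empty        = refl
╲-identityʳ (node l x r) = cong (node l x) (╲-identityʳ r)

graft-identityˡ : ∀ c (t : BinTree N) → graft c empty t ≡ t
graft-identityˡ true  = ╱-identityˡ
graft-identityˡ false = λ _ → refl

graft-identityʳ : ∀ c (t : BinTree N) → graft c t empty ≡ t
graft-identityʳ true  = λ _ → refl
graft-identityʳ false = ╲-identityʳ

canopy-singleton : ∀ {p} (t : BinTree N) → leafBits 0b t ≡ [ p ] → canopy t ≡ []
canopy-singleton t eq rewrite eq = take-[] (#nodes t ∸ 1)

leafBits-canopy : ∀ (l : BinTree N) x r → leafBits 0b (node l x r) ≡ 1b ∷ canopy (node l x r) ∷ʳ 0b
leafBits-canopy l x r =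
  let K , ends = leafBits-ends l x r in
  trans (ends 0b) (cong (λ L → 1b ∷ L ∷ʳ 0b) (sym (canopy-leafBits (node l x r) (ends 0b))))

-- Where the two trees meet, `╱` drops the initial 1 of the second and keeps the final 0 of `s`,
-- while `╲` does the opposite.
leafBits-graft : ∀ c {K L σ} (s : BinTree N) l x r →
  leafBits 1b s ≡ 1b ∷ K ∷ʳ 0b → leafBits 0b s ≡ 1b ∷ K ∷ʳ 0b → leafBits σ (node l x r) ≡ 1b ∷ L ∷ʳ 0b →
  leafBits 0b (graft c s (node l x r)) ≡ 1b ∷ (K ++ bit (not c) ∷ L) ∷ʳ 0b
leafBits-graft true  {K} {L} s l x r eq₁ _ eq with leafBits-╱ s (node l x r)
... | K′ , eqK′ , eq╱ = begin
  -- A nonempty tree ignores the bit passed down, so the 0 of the goal may be read as 1.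
  leafBits 1b (s ╱ node l x r)      ≡⟨ eq╱ ⟩
  leafBits 1b s ++ K′               ≡⟨ cong₂ _++_ eq₁ (∷-injectiveʳ (trans (sym eqK′) eq)) ⟩
  (1b ∷ K ∷ʳ 0b) ++ L ∷ʳ 0b         ≡⟨ ++-assoc (1b ∷ K) [ 0b ] (L ∷ʳ 0b) ⟩
  1b ∷ K ++ 0b ∷ L ∷ʳ 0b            ≡⟨ ++-assoc (1b ∷ K) (0b ∷ L) [ 0b ] ⟨
  1b ∷ (K ++ 0b ∷ L) ∷ʳ 0b          ∎
  where open ≡-Reasoning
leafBits-graft false {K} {L} s l x r _ eq₀ eq with leafBits-╲ s (node l x r)
... | K′ , eqK′ , eq╲ = begin
  leafBits 0b (s ╲ node l x r)      ≡⟨ eq╲ ⟩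
  K′ ++ leafBits 0b (node l x r)    ≡⟨ cong₂ _++_ (∷ʳ-injectiveˡ K′ (1b ∷ K) (trans (sym eqK′) eq₀)) eq ⟩
  1b ∷ K ++ 1b ∷ L ∷ʳ 0b            ≡⟨ ++-assoc (1b ∷ K) (1b ∷ L) [ 0b ] ⟨
  1b ∷ (K ++ 1b ∷ L) ∷ʳ 0b          ∎
  where open ≡-Reasoning

bit-not-≢ : ∀ c → bit (not c) ≢ bit c
bit-not-≢ true  ()
bit-not-≢ false ()

-- Around its root T_L has the bits 0 and 1 wherever A and B are nonempty, so T_R has 1 and 0 there.
-- If A or B is empty, the first leaf 1 or the last leaf 0 of T_R, outside its canopy, supplies the
-- missing bit. The conclusion covers both values of `c`, which only the later pruning determines.
opposite-leaves : ∀ (A : BinTree N) a B (TR : BinTree N) {K} →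
  Pointwise _≢_ (canopy (node A a B)) K → leafBits 0b TR ≡ 1b ∷ K ∷ʳ 0b →
  ∃[ X ] ∃[ Y ] (leafBits 0b TR ≡ X ++ 1b ∷ 0b ∷ Y × length X ≡ #nodes A ×
    (∀ c (TR′ : BinTree N) → leafBits 0b TR′ ≡ X ++ bit c ∷ Y →
     Pointwise _≢_ (canopy (graft c A B)) (canopy TR′)))
opposite-leaves empty a empty TR [] eq =
  [] , [] , eq , refl , λ c TR′ eq′ →
    subst (λ t → Pointwise _≢_ (canopy t) (canopy TR′)) (sym (graft-identityˡ c empty))
      (subst (Pointwise _≢_ []) (sym (canopy-singleton TR′ eq′)) [])
opposite-leaves empty a B@(node l x r) TR {K} K≢ eq
  with L , ends ← leafBits-ends l x r
  with 1≢k ∷ L≢ ← subst (λ M → Pointwise _≢_ M K) (canopy-leafBits {K = 1b ∷ L} (node empty a B) (cong (1b ∷_) (ends 0b))) K≢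
  with refl ← ≢1b⇒0b 1≢k
  = [] , _ , eq , refl , λ c TR′ eq′ →
    subst (λ t → Pointwise _≢_ (canopy t) (canopy TR′)) (sym (graft-identityˡ c B))
      (subst₂ (Pointwise _≢_) (sym (canopy-leafBits B (ends 0b))) (sym (canopy-leafBits TR′ eq′)) L≢)
opposite-leaves A@(node l x r) a empty TR {K} K≢ eq
  with L , ends ← leafBits-ends l x r
  with M , _ , refl , L≢ , (0≢k ∷ []) ← pointwise-++⁻ L
         (subst (λ M → Pointwise _≢_ M K) (canopy-leafBits {K = L ∷ʳ 0b} (node A a empty) (cong (_∷ʳ 0b) (ends 1b))) K≢)
  with refl ← ≢0b⇒1b 0≢k
  = 1b ∷ M , [] , trans eq (++-assoc (1b ∷ M) [ 1b ] [ 0b ])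
  , trans (cong suc (sym (Pointwise-length L≢))) (sym (length-∷-∷ʳ {σ = 0b} A (ends 0b)))
  , λ c TR′ eq′ →
    subst (λ t → Pointwise _≢_ (canopy t) (canopy TR′)) (sym (graft-identityʳ c A))
      (subst₂ (Pointwise _≢_) (sym (canopy-leafBits A (ends 0b))) (sym (canopy-leafBits TR′ eq′)) L≢)
opposite-leaves A@(node l x r) a B@(node l′ x′ r′) TR {K} K≢ eq
  with L , ends ← leafBits-ends l x r
  with L′ , ends′ ← leafBits-ends l′ x′ r′
  with M , _ , refl , L≢ , (_∷_ {ys = N} 0≢k (1≢k′ ∷ L′≢)) ← pointwise-++⁻ L
         (subst (λ M → Pointwise _≢_ M K)
           (canopy-leafBits {K = L ++ 0b ∷ 1b ∷ L′} (node A a B)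
             (trans (cong₂ _++_ (ends 1b) (ends′ 0b))
                    (trans (++-assoc (1b ∷ L) [ 0b ] (1b ∷ L′ ∷ʳ 0b)) (sym (++-assoc (1b ∷ L) (0b ∷ 1b ∷ L′) [ 0b ])))))
           K≢)
  with refl ← ≢0b⇒1b 0≢k
  with refl ← ≢1b⇒0b 1≢k′
  = 1b ∷ M , _ , trans eq (++-assoc (1b ∷ M) _ [ 0b ])
  , trans (cong suc (sym (Pointwise-length L≢))) (sym (length-∷-∷ʳ {σ = 0b} A (ends 0b)))
  , λ c TR′ eq′ →
    subst₂ (Pointwise _≢_)
      (sym (canopy-leafBits (graft c A B) (leafBits-graft c {σ = 0b} A l′ x′ r′ (ends 1b) (ends 0b) (ends′ 0b))))
      (sym (canopy-leafBits TR′ (trans eq′ (sym (++-assoc (1b ∷ M) (bit c ∷ _) [ 0b ])))))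
      (Pointwise.++⁺ L≢ (bit-not-≢ c ∷ L′≢))

-- Invariant of the loop and correctness

#nodes-cong : (s t : BinTree N) → labels s ≡ labels t → #nodes s ≡ #nodes t
#nodes-cong s t eq = trans (sym (length-labels s)) (trans (cong length eq) (length-labels t))

#nodes-graft : ∀ c (s t : BinTree N) → #nodes (graft c s t) ≡ #nodes s + #nodes t
#nodes-graft c s t = begin
  #nodes (graft c s t)              ≡⟨ length-labels (graft c s t) ⟨
  length (labels (graft c s t))     ≡⟨ cong length (labels-graft c s t) ⟩
  length (labels s ++ labels t)     ≡⟨ length-++ (labels s) ⟩
  length (labels s) + length (labels t) ≡⟨ cong₂ _+_ (length-labels s) (length-labels t) ⟩
  #nodes s + #nodes t               ∎
  where open ≡-Reasoning

#nodes≡0⇒empty : (t : BinTree N) → #nodes t ≡ 0 → t ≡ empty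
#nodes≡0⇒empty empty        _  = refl
#nodes≡0⇒empty (node l x r) eq = contradiction (trans (sym (+-suc (#nodes l) (#nodes r))) eq) λ ()

++-∷-injective : ∀ {X : Set} {x y : X} us {vs} xs {ys} → length us ≡ length xs →
                 us ++ x ∷ vs ≡ xs ++ y ∷ ys → us ≡ xs × x ≡ y × vs ≡ ys
++-∷-injective []       []       _   refl = refl , refl , refl
++-∷-injective (_ ∷ us) (_ ∷ xs) len eq with refl , eq′ ← ∷-injective eq
  with refl , eqs ← ++-∷-injective us xs (suc-injective len) eq′ = refl , eqs

-- One iteration preserves twin binary search trees. The canopies show which node of T_R is
-- childless; cutting the equal inorder readings at its index shows that its label is a.
twin-prune : ∀ {A B TR} → TwinBST (node A a B) TR →
  ∃[ TR′ ] ∃[ c ] (Prune a false (#nodes A) TR TR′ c × TwinBST (graft c A B) TR′)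
twin-prune {a} {A} {B} {empty} tb =
  contradiction (trans (sym (+-suc (#nodes A) (#nodes B))) (proj₁ (TwinBST.twin tb))) λ ()
twin-prune {a} {A} {B} {TR@(node l x r)} tb
  with X , Y , eq , len , opposite ←
         opposite-leaves A a B TR (proj₂ (TwinBST.twin tb)) (leafBits-canopy l x r)
  with a′ , TR′ , c , p , eq′ ← prune-leafBits false TR X eq
  with xs , ys , len′ , eqTR , eqTR′ ← prune-labels p
  with eqA , refl , eqB ← ++-∷-injective (labels A) xs (trans (length-labels A) (sym (trans len′ len)))
         (trans (sym (toList≡labels (node A a B))) (trans (TwinBST.inorder tb) (trans (toList≡labels TR) eqTR)))
  = TR′ , c , subst (λ i → Prune a false i TR TR′ c) len p , record
  { twin     = #nodes-cong (graft c A B) TR′ same , opposite c TR′ eq′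
  ; leftBST  = leftBST-graft c (TwinBST.leftBST tb)
  ; rightBST = prune-rightBST p (TwinBST.rightBST tb)
  ; inorder  = trans (toList≡labels (graft c A B)) (trans same (sym (toList≡labels TR′)))
  }
  where
  same : labels (graft c A B) ≡ labels TR′
  same = trans (labels-graft c A B) (trans (cong₂ _++_ eqA eqB) (sym eqTR′))

loop-step : ∀ {n u TR TR′ c} → Prune a false (#nodes A) TR TR′ c →
            loop (suc n) (node A a B) TR u ≡ loop n (graft c A B) TR′ (u ∷ʳ a)
loop-step {a} {A} {B} {n} {u} {TR@(node _ _ _)} p =
  cong₂ (λ m e → m >>= λ TR′ → loop n (graft e A B) TR′ (u ∷ʳ a)) (prune-suppress p) (prune-isLeftChildIn p)

-- The word `w` is chosen before the accumulator `u`, because the recursive call runs with `u ∷ʳ a`.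
loop-correct : ∀ n TL TR → #nodes TL ≡ n → TwinBST TL TR →
  ∃[ w ] ((∀ u → loop n TL TR u ≡ just (u ++ w)) × Extraction TL w × foldr insertᴿ empty w ≡ TR)
loop-correct n empty TR _ tb =
  [] , (λ u → trans (loop-empty n u) (cong just (sym (++-identityʳ u)))) , []
  , sym (#nodes≡0⇒empty TR (sym (proj₁ (TwinBST.twin tb))))
  where
  loop-empty : ∀ n u → loop n empty TR u ≡ just u
  loop-empty zero    u = refl
  loop-empty (suc n) u = refl
loop-correct zero (node A a B) TR eq _ = contradiction (trans (sym (+-suc (#nodes A) (#nodes B))) eq) λ ()
loop-correct (suc n) (node A a B) TR eq tb =
  let TR′ , c , p , tb′ = twin-prune tb
      size = trans (#nodes-graft c A B) (suc-injective (trans (sym (+-suc (#nodes A) (#nodes B))) eq))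
      w , run , ext , insR = loop-correct n (graft c A B) TR′ size tb′
  in a ∷ w
   , (λ u → trans (loop-step {n = n} {u} p) (trans (run (u ∷ʳ a)) (cong just (++-assoc u [ a ] w))))
   , step c ext
   -- Read from the right, `a ∷ w` inserts a last, which restores the suppressed node.
   , trans (cong (insertᴿ a) insR) (prune-insertᴿ p (TwinBST.rightBST tb))

proposition4p12 : ∀ (TL TR : BinTree Letter) → TwinBST TL TR →
    ∃[ w ] (extractBaxter TL TR ≡ just w
    × InEncodedClass (TL , TR) w
    × (LabeledByPermutation TL × LabeledByPermutation TR → IsBaxterPermutation w))
proposition4p12 TL TR tb with w , run , ext , insR ← loop-correct (#nodes TL) TL TR refl tb =
  -- Inserting `w` gives back the input pair, so `w` is itself the witness for the encoded class.
  w , run [] , (w , cong₂ _,_ (extraction-insertᴸ leftBST ext) insR , _≡B_.refl)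
  , λ (permL , _) → extraction-baxter leftBST ext
      (↭-trans (↭-sym (extraction-↭ ext))
        (subst₂ _↭_ (toList≡labels TL)
          (cong (applyUpTo suc) (trans (sym (length-labels TL)) (↭-length (extraction-↭ ext)))) permL))
  where open TwinBST tb
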